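{- The class $R(\sqsubseteq,;)$ cannot be defined by any finite set of first-order axioms in the signature $(\leq,\circ)$.
   Context: For binary relations $R,S$ on a set $X$: $R;S=\{(x,y):\exists z\,((x,z)\in R\wedge(z,y)\in S)\}$; $\mathrm{dom}(S)=\{x:\exists y\,(x,y)\in S\}$; $R\restriction_{Y}=\{(x,y)\in R: x\in Y\}$; demonic refinement $R\sqsubseteq S\iff(\mathrm{dom}(S)\subseteq\mathrm{dom}(R)\wedge R\restriction_{\mathrm{dom}(S)}\subseteq S)$. A $(\leq,\circ)$-structure is a set with a binary relation $\leq$ and a binary operation $\circ$. $R(\sqsubseteq,;)$ is the class of $(\leq,\circ)$-structures isomorphic to a set of binary relations on some base set, closed under $;$, with $\leq$ interpreted as $\sqsubseteq$ and $\circ$ as $;$. -}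

module Defs where

open import Data.Nat using (ℕ; suc)
open import Data.Fin using (Fin; zero; suc)
open import Data.List using (List; []; _∷_)
open import Data.Product using (Σ; _×_; _,_)
open import Data.Empty using (⊥)
open import Data.Unit using (⊤)
open import Relation.Binary.PropositionalEquality using (_≡_)

BinRel : Set → Set₁
BinRel X = X → X → Set

_⨾_ : {X : Set} → BinRel X → BinRel X → BinRel X
(R ⨾ S) x y = Σ _ λ z → R x z × S z y

dom : {X : Set} → BinRel X → X → Set
dom S x = Σ _ λ y → S x y

_⊆ᵣ_ : {X : Set} → BinRel X → BinRel X → Set
R ⊆ᵣ S = ∀ x y → R x y → S x y

_≐_ : {X : Set} → BinRel X → BinRel X → Set
R ≐ S = (R ⊆ᵣ S) × (S ⊆ᵣ R)

_⊑_ : {X : Set} → BinRel X → BinRel X → Set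
R ⊑ S = (∀ x → dom S x → dom R x) × (∀ x y → dom S x → R x y → S x y)

record Structure : Set₁ where
  field
    Carrier : Set
    _≤_     : Carrier → Carrier → Set
    _∘_     : Carrier → Carrier → Carrier

-- M ∈ R(⊑,;): there is a base set X and an embedding f of M into the
-- binary relations on X (injective up to equality of relations),
-- turning ∘ into ; and ≤ into ⊑ (both directions).  The image of f is
-- then a set of relations closed under ; and f is an isomorphism onto it.
InR : Structure → Set₁
InR M = Σ Set λ X → Σ (Carrier → BinRel X) λ f →
          (∀ a b → f a ≐ f b → a ≡ b)
        × (∀ a b → f (a ∘ b) ≐ (f a ⨾ f b))
        × (∀ a b → (a ≤ b → f a ⊑ f b) × (f a ⊑ f b → a ≤ b))
  where open Structure M

-- First-order logic (with equality) in the signature (≤,∘).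
-- Variables are de Bruijn indices; connectives ⊥, ⇒, ∀ form a
-- classically complete basis (¬, ∧, ∨, ∃ are definable).

data Term (n : ℕ) : Set where
  var  : Fin n → Term n
  _·_  : Term n → Term n → Term n

data Formula (n : ℕ) : Set where
  _≈_  : Term n → Term n → Formula n
  _≼_  : Term n → Term n → Formula n
  fls  : Formula n
  _⇒_  : Formula n → Formula n → Formula n
  all  : Formula (suc n) → Formula n

Sentence : Set
Sentence = Formula 0

module _ (M : Structure) where
  open Structure M

  Env : ℕ → Set
  Env n = Fin n → Carrier

  extend : ∀ {n} → Carrier → Env n → Env (suc n)
  extend a ρ zero    = a
  extend a ρ (suc i) = ρ i

  evalT : ∀ {n} → Env n → Term n → Carrier
  evalT ρ (var i) = ρ i
  evalT ρ (s · t) = evalT ρ s ∘ evalT ρ t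

  Sat : ∀ {n} → Env n → Formula n → Set
  Sat ρ (s ≈ t) = evalT ρ s ≡ evalT ρ t
  Sat ρ (s ≼ t) = evalT ρ s ≤ evalT ρ t
  Sat ρ fls     = ⊥
  Sat ρ (φ ⇒ ψ) = Sat ρ φ → Sat ρ ψ
  Sat ρ (all φ) = (a : Carrier) → Sat (extend a ρ) φ

  empty : Env 0
  empty ()

  Models : Sentence → Set
  Models σ = Sat empty σ

  ModelsAll : List Sentence → Set
  ModelsAll []      = ⊤
  ModelsAll (σ ∷ Γ) = Models σ × ModelsAll Γ

Axiomatises : List Sentence → Set₁
Axiomatises Γ = (M : Structure) → (ModelsAll M Γ → InR M) × (InR M → ModelsAll M Γ)

{-# OPTIONS --safe #-}
-- For a set P of points with a shift s, consider the structure with elements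
-- w, p, q, c, o and a g, b g (g ∈ P), whose only products other than o are
--   b g ∘ c = a g,   q ∘ c = p,   w ∘ a g = p,   w ∘ b g = q,
-- and whose order is reflexive with top o and a (s g) ≤ b g.
-- In a representation dom (a g) ⊆ dom (b g) ⊆ dom (a (s g)).  If s has a cycle,
-- all the domains along it agree, so a (s g) ⊆ b g on a common domain, and
-- composing with w on the left forces the missing inequality p ≤ q.  If the
-- orbits of s are infinite, the structure has an explicit representation.
-- Infinitely many long cycles and infinitely many copies of ℤ cannot be
-- told apart by sentences of small quantifier rank (Ehrenfeucht–Fraïssé game).
module Submission where

open import Defs
open import Data.Empty using (⊥-elim)
open import Data.Fin using (Fin; zero; suc; toℕ)
open import Data.Fin.Properties using (any?; toℕ-injective; toℕ<n; toℕ-fromℕ<)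
  renaming (_≟_ to _≟ᶠ_)
open import Data.Integer using (ℤ; +_; 0ℤ)
import Data.Integer as ℤ
import Data.Integer.Properties as ℤ
open import Algebra.Properties.AbelianGroup ℤ.+-0-abelianGroup using (∙-cancelʳ)
open import Data.List using (List; []; _∷_)
open import Data.Nat using (ℕ; zero; suc; _+_; _*_; _⊔_; _≤_; _<_; z≤n; s≤s)
open import Data.Nat.DivMod
  using (_%_; _mod_; m<n⇒m%n≡m; m%n%n≡m%n; %-distribˡ-+; [m+kn]%n≡m%n)
open import Data.Nat.Properties hiding (_≟_)
import Data.Nat.Properties as ℕ
open import Data.Product using (Σ; ∃; _×_; _,_; proj₁; proj₂; swap)
open import Data.Product.Properties using (≡-dec)
open import Data.Unit using (⊤; tt)
import Data.Vec.Functional as Vector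
open import Function using (_∘_)
open import Relation.Binary using (DecidableEquality)
open import Relation.Binary.PropositionalEquality
open import Relation.Nullary using (¬_; Dec; yes; no)

open ≡-Reasoning

private
  variable
    n : ℕ
    P Q : Set

-- Elements over a set of points and their product.

data Element (P : Set) : Set where
  w p q c o : Element P
  a b       : P → Element P

_∙_ : Element P → Element P → Element P
w   ∙ a g = p
w   ∙ b g = q
q   ∙ c   = p
b g ∙ c   = a g
_   ∙ _   = o

map : (P → Q) → Element P → Element Q
map f w     = w
map f p     = p
map f q     = q
map f c     = c
map f o     = o
map f (a g) = a (f g)
map f (b g) = b (f g)

-- No product compares points, so renaming them commutes with `∙`; terms can then be evaluated on
-- indices of played points.
map-∙ : ∀ (f : P → Q) x y → map f (x ∙ y) ≡ map f x ∙ map f y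
map-∙ f w w = refl
map-∙ f w p = refl
map-∙ f w q = refl
map-∙ f w c = refl
map-∙ f w o = refl
map-∙ f w (a _) = refl
map-∙ f w (b _) = refl
map-∙ f q w = refl
map-∙ f q p = refl
map-∙ f q q = refl
map-∙ f q c = refl
map-∙ f q o = refl
map-∙ f q (a _) = refl
map-∙ f q (b _) = refl
map-∙ f (b _) w = refl
map-∙ f (b _) p = refl
map-∙ f (b _) q = refl
map-∙ f (b _) c = refl
map-∙ f (b _) o = refl
map-∙ f (b _) (a _) = refl
map-∙ f (b _) (b _) = refl
map-∙ f p _ = refl
map-∙ f c _ = refl
map-∙ f o _ = refl
map-∙ f (a _) _ = refl

map-suc : ∀ (x : P) (g : Fin n → P) e → map (x Vector.∷ g) (map suc e) ≡ map g e
map-suc x g w     = refl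
map-suc x g p     = refl
map-suc x g q     = refl
map-suc x g c     = refl
map-suc x g o     = refl
map-suc x g (a i) = refl
map-suc x g (b i) = refl

a-injective : {g h : P} → a g ≡ a h → g ≡ h
a-injective refl = refl

b-injective : {g h : P} → b g ≡ b h → g ≡ h
b-injective refl = refl

-- Invertible shifts, copies and freeness.

record Orbit : Set₁ where
  field
    Pt            : Set
    origin        : Pt
    _≟_           : DecidableEquality Pt
    shift         : ℕ → Pt → Pt
    unshift       : ℕ → Pt → Pt
    shift-zero    : ∀ x → shift 0 x ≡ x
    shift-+       : ∀ j k x → shift j (shift k x) ≡ shift (j + k) x
    shift-unshift : ∀ k x → shift k (unshift k x) ≡ x
    unshift-shift : ∀ k x → unshift k (shift k x) ≡ x

  shift-injective : ∀ k {x y} → shift k x ≡ shift k y → x ≡ y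
  shift-injective k {x} {y} eq = begin
    x                     ≡⟨ unshift-shift k x ⟨
    unshift k (shift k x) ≡⟨ cong (unshift k) eq ⟩
    unshift k (shift k y) ≡⟨ unshift-shift k y ⟩
    y                     ∎

  -- Shifts commute, so once shifted by `m`, every iterate of `x` becomes an iterate of `z`.
  slide : ∀ {m n x z} k → shift m x ≡ shift n z → shift m (shift k x) ≡ shift (k + n) z
  slide {m} {n} {x} {z} k eq = begin
    shift m (shift k x) ≡⟨ shift-+ m k x ⟩
    shift (m + k) x     ≡⟨ cong (λ j → shift j x) (+-comm m k) ⟩
    shift (k + m) x     ≡⟨ shift-+ k m x ⟨
    shift k (shift m x) ≡⟨ cong (shift k) eq ⟩
    shift k (shift n z) ≡⟨ shift-+ k n z ⟩
    shift (k + n) z     ∎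

open Orbit

-- A point unrelated to all earlier ones is answered in the game by a point of
-- an unused copy.
copies : Orbit → Orbit
copies O .Pt = ℕ × O .Pt
copies O .origin = 0 , O .origin
copies O ._≟_ = ≡-dec ℕ._≟_ (O ._≟_)
copies O .shift k (i , x) = i , O .shift k x
copies O .unshift k (i , x) = i , O .unshift k x
copies O .shift-zero (i , x) = cong (i ,_) (O .shift-zero x)
copies O .shift-+ j k (i , x) = cong (i ,_) (O .shift-+ j k x)
copies O .shift-unshift k (i , x) = cong (i ,_) (O .shift-unshift k x)
copies O .unshift-shift k (i , x) = cong (i ,_) (O .unshift-shift k x)

-- Every cycle has length at least `B`; offsets below `B` do not tell it from an infinite orbit.
FreeBelow : ℕ → Orbit → Set
FreeBelow B O = ∀ x {k l} → k < B → l < B → O .shift k x ≡ O .shift l x → k ≡ l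

copies-free : ∀ {B} O → FreeBelow B O → FreeBelow B (copies O)
copies-free O free (i , x) k<B l<B eq = free x k<B l<B (cong proj₂ eq)

strictUpperBound : (f : Fin n → ℕ) → ∃ λ m → ∀ i → f i < m
strictUpperBound {zero}  f = 0 , λ ()
strictUpperBound {suc n} f with strictUpperBound (f ∘ suc)
... | m , f<m = suc (f zero) ⊔ m , λ where
  zero    → m≤m⊔n (suc (f zero)) m
  (suc i) → ≤-trans (f<m i) (m≤n⊔m (suc (f zero)) m)

-- Offsets on both sides express a signed distance without subtraction.
Far : ∀ O → ℕ → O .Pt → (Fin n → O .Pt) → Set
Far O N x g = ∀ i {k l} → k < N → l < N → O .shift k x ≢ O .shift l (g i)

-- A copy index above all those in use gives an orbit that meets none of the earlier points.
fresh : ∀ O (g : Fin n → copies O .Pt) → ∃ λ x → ∀ N → Far (copies O) N x g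
fresh O g with strictUpperBound (proj₁ ∘ g)
... | m , g<m = (m , O .origin) , λ N i _ _ eq → <⇒≢ (g<m i) (sym (cong proj₁ eq))

-- One round of the game on points.

module _ (G H : Orbit) where

  Transfers : ℕ → (Fin n → G .Pt) → (Fin n → H .Pt) → Set
  Transfers N g h = ∀ i j {k l} → k < N → l < N →
    G .shift k (g i) ≡ G .shift l (g j) → H .shift k (h i) ≡ H .shift l (h j)

  transfers-mono : ∀ {M N} {g : Fin n → G .Pt} {h} → M ≤ N → Transfers N g h → Transfers M g h
  transfers-mono M≤N t i j k<M l<M = t i j (<-≤-trans k<M M≤N) (<-≤-trans l<M M≤N)

  -- As `x` is tied to `g i`, a relation between `x` and `x` or an old point, shifted by `m`,
  -- becomes one among old points at offsets below `N + N`. That one transfers, and the shift by `m`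
  -- cancels in `H`.
  transfers-near : ∀ {N k l i x y} {g : Fin n → G .Pt} {h} → k < N → l < N →
    G .shift k x ≡ G .shift l (g i) → H .shift k y ≡ H .shift l (h i) →
    Transfers (N + N) g h → Transfers N (x Vector.∷ g) (y Vector.∷ h)
  transfers-near {N = N} {m} {n} {i} {x} {y} {g} {h} m<N n<N xg yh t = go
    where
    go : Transfers N (x Vector.∷ g) (y Vector.∷ h)
    go zero zero {k} {l} k<N l<N eq = shift-injective H m (begin
      H .shift m (H .shift k y) ≡⟨ slide H k yh ⟩
      H .shift (k + n) (h i)    ≡⟨ t i i (+-mono-< k<N n<N) (+-mono-< l<N n<N) (begin
        G .shift (k + n) (g i)    ≡⟨ slide G k xg ⟨
        G .shift m (G .shift k x) ≡⟨ cong (G .shift m) eq ⟩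
        G .shift m (G .shift l x) ≡⟨ slide G l xg ⟩
        G .shift (l + n) (g i)    ∎) ⟩
      H .shift (l + n) (h i)    ≡⟨ slide H l yh ⟨
      H .shift m (H .shift l y) ∎)
    go zero (suc j) {k} {l} k<N l<N eq = shift-injective H m (begin
      H .shift m (H .shift k y)     ≡⟨ slide H k yh ⟩
      H .shift (k + n) (h i)        ≡⟨ t i j (+-mono-< k<N n<N) (+-mono-< m<N l<N) (begin
        G .shift (k + n) (g i)        ≡⟨ slide G k xg ⟨
        G .shift m (G .shift k x)     ≡⟨ cong (G .shift m) eq ⟩
        G .shift m (G .shift l (g j)) ≡⟨ G .shift-+ m l (g j) ⟩
        G .shift (m + l) (g j)        ∎) ⟩
      H .shift (m + l) (h j)        ≡⟨ H .shift-+ m l (h j) ⟨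
      H .shift m (H .shift l (h j)) ∎)
    go (suc i′) zero k<N l<N eq = sym (go zero (suc i′) l<N k<N (sym eq))
    go (suc i′) (suc j) k<N l<N eq = transfers-mono (m≤m+n N N) t i′ j k<N l<N eq

  -- Distance rules out relations of `x` to old points, and freeness makes those of `x` to itself
  -- trivial.
  transfers-far : ∀ {N x y} {g : Fin n → G .Pt} {h} → FreeBelow N G → Far G N x g →
    Transfers N g h → Transfers N (x Vector.∷ g) (y Vector.∷ h)
  transfers-far {y = y} free far t zero    zero    k<N l<N eq =
    cong (λ k → H .shift k y) (free _ k<N l<N eq)
  transfers-far free far t zero    (suc j) k<N l<N eq = ⊥-elim (far j k<N l<N eq)
  transfers-far free far t (suc i) zero    k<N l<N eq = ⊥-elim (far i l<N k<N (sym eq))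
  transfers-far free far t (suc i) (suc j) k<N l<N eq = t i j k<N l<N eq

Near : ∀ O → ℕ → O .Pt → (Fin n → O .Pt) → Set
Near O N x g = ∃ λ i → ∃ λ k → k < N × ∃ λ l → l < N × O .shift k x ≡ O .shift l (g i)

near? : ∀ O N x (g : Fin n → O .Pt) → Dec (Near O N x g)
near? O N x g = any? λ i → anyUpTo? (λ k → anyUpTo? (λ l → O ._≟_ _ _) N) N

Similar : ∀ G H → ℕ → (Fin n → G .Pt) → (Fin n → H .Pt) → Set
Similar G H N g h = Transfers G H N g h × Transfers H G N h g

forth : ∀ G H {N} {g : Fin n → G .Pt} {h} → FreeBelow N G → FreeBelow N (copies H) →
  Similar G (copies H) (N + N) g h →
  ∀ x → ∃ λ y → Similar G (copies H) N (x Vector.∷ g) (y Vector.∷ h)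
forth G H′ {N} {g} {h} freeG freeH (t , t⁻) x with near? G N x g
... | yes (i , k , k<N , l , l<N , eq) =
  y , transfers-near G H k<N l<N eq eq′ t , transfers-near H G k<N l<N eq′ eq t⁻
  where
  H = copies H′
  -- `y` is placed relative to `h i` as `x` is relative to `g i`.
  y = H .unshift k (H .shift l (h i))
  eq′ : H .shift k y ≡ H .shift l (h i)
  eq′ = H .shift-unshift k _
... | no ¬near with fresh H′ h
...   | y , far = y
  , transfers-far G H freeG (λ i k<N l<N eq → ¬near (i , _ , k<N , _ , l<N , eq))
      (transfers-mono G H (m≤m+n N N) t)
  , transfers-far H G freeH (far N) (transfers-mono H G (m≤m+n N N) t⁻)
  where H = copies H′

-- The ordered structure on an orbit and the matching of elements.

module _ (O : Orbit) where

  _⊴_ : Element (O .Pt) → Element (O .Pt) → Set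
  x   ⊴ o   = ⊤
  a g ⊴ b h = g ≡ O .shift 1 h
  x   ⊴ y   = x ≡ y

  chain : Structure
  chain = record { Carrier = Element (O .Pt) ; _≤_ = _⊴_ ; _∘_ = _∙_ }

module _ (G H : Orbit) where

  -- The common name `e` over indices of played points makes constants match at no cost and reduces
  -- products to `map-∙`.
  Match : (Fin n → G .Pt) → (Fin n → H .Pt) → Element (G .Pt) → Element (H .Pt) → Set
  Match g h x y = ∃ λ e → x ≡ map g e × y ≡ map h e

  module _ {g : Fin n → G .Pt} {h : Fin n → H .Pt} where

    match-weaken : ∀ {x y u v} → Match g h u v → Match (x Vector.∷ g) (y Vector.∷ h) u v
    match-weaken (e , refl , refl) = map suc e , sym (map-suc _ _ e) , sym (map-suc _ _ e)

    match-evalT : ∀ {m ρ σ} → (∀ i → Match g h (ρ i) (σ i)) →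
      (t : Term m) → Match g h (evalT (chain G) ρ t) (evalT (chain H) σ t)
    match-evalT ρσ (var i) = ρσ i
    match-evalT ρσ (s · t) with match-evalT ρσ s | match-evalT ρσ t
    ... | d , eq₁ , eq₂ | e , eq₃ , eq₄ = d ∙ e
      , trans (cong₂ _∙_ eq₁ eq₃) (sym (map-∙ g d e))
      , trans (cong₂ _∙_ eq₂ eq₄) (sym (map-∙ h d e))

    module _ (t : Transfers G H 2 g h) where

      map-≡ : ∀ d e → map g d ≡ map g e → map h d ≡ map h e
      map-≡ w     w     _  = refl
      map-≡ p     p     _  = refl
      map-≡ q     q     _  = refl
      map-≡ c     c     _  = refl
      map-≡ o     o     _  = refl
      map-≡ (a i) (a j) eq = cong a (shift-injective H 0
        (t i j (s≤s z≤n) (s≤s z≤n) (cong (G .shift 0) (a-injective eq))))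
      map-≡ (b i) (b j) eq = cong b (shift-injective H 0
        (t i j (s≤s z≤n) (s≤s z≤n) (cong (G .shift 0) (b-injective eq))))

      -- The one kind of pair beyond equality and top compares offset `0` with offset `1`, hence
      -- transfer below `2`.
      map-⊴ : ∀ d e → _⊴_ G (map g d) (map g e) → _⊴_ H (map h d) (map h e)
      map-⊴ d     o     _  = tt
      map-⊴ (a i) (b j) eq = trans (sym (H .shift-zero (h i)))
        (t i j (s≤s z≤n) (s≤s (s≤s z≤n)) (trans (G .shift-zero (g i)) eq))
      map-⊴ w     (b j) ()
      map-⊴ p     (b j) ()
      map-⊴ q     (b j) ()
      map-⊴ c     (b j) ()
      map-⊴ o     (b j) ()
      map-⊴ (b i) (b j) eq = map-≡ (b i) (b j) eq
      map-⊴ d     w     eq = map-≡ d w eq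
      map-⊴ d     p     eq = map-≡ d p eq
      map-⊴ d     q     eq = map-≡ d q eq
      map-⊴ d     c     eq = map-≡ d c eq
      map-⊴ d     (a j) eq = map-≡ d (a j) eq

-- The game on elements and the transfer of sentences.

match-sym : ∀ G H {g : Fin n → G .Pt} {h : Fin n → H .Pt} {x y} →
  Match G H g h x y → Match H G h g y x
match-sym G H (e , eq , eq′) = e , eq′ , eq

-- A constant costs no point while `a x` and `b x` play the point `x`, so the length of the new
-- tuple is existential.
answer : ∀ G H {N} {g : Fin n → G .Pt} {h} → FreeBelow N G → FreeBelow N (copies H) →
  Similar G (copies H) (N + N) g h → ∀ x → ∃ λ y → ∃ λ m →
  Σ (Fin m → G .Pt) λ g′ → Σ (Fin m → copies H .Pt) λ h′ →
    Similar G (copies H) N g′ h′ × Match G (copies H) g′ h′ x y ×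
    (∀ {u v} → Match G (copies H) g h u v → Match G (copies H) g′ h′ u v)
answer {n} G H {N} {g} {h} freeG freeH s@(t , t⁻) = λ where
    w → keep w
    p → keep p
    q → keep q
    c → keep c
    o → keep o
    (a x) → let y , s′ = forth G H freeG freeH s x in
      a y , _ , _ , _ , s′ , (a zero , refl , refl) , match-weaken G (copies H)
    (b x) → let y , s′ = forth G H freeG freeH s x in
      b y , _ , _ , _ , s′ , (b zero , refl , refl) , match-weaken G (copies H)
  where
  keep : (e : Element (Fin n)) → ∃ λ y → ∃ λ m →
    Σ (Fin m → G .Pt) λ g′ → Σ (Fin m → copies H .Pt) λ h′ →
    Similar G (copies H) N g′ h′ × Match G (copies H) g′ h′ (map g e) y ×
    (∀ {u v} → Match G (copies H) g h u v → Match G (copies H) g′ h′ u v)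
  keep e = map h e , _ , g , h
    , (transfers-mono G (copies H) (m≤m+n N N) t , transfers-mono (copies H) G (m≤m+n N N) t⁻)
    , (e , refl , refl) , λ m → m

-- An answer at offset below N to one known point is tested against the others
-- at offsets below N + N, hence the doubling.
radius : ℕ → ℕ
radius zero    = 2
radius (suc r) = radius r + radius r

2≤radius : ∀ r → 2 ≤ radius r
2≤radius zero    = ≤-refl
2≤radius (suc r) = ≤-trans (2≤radius r) (m≤m+n _ _)

rank : Formula n → ℕ
rank (s ≈ t) = 0
rank (s ≼ t) = 0
rank fls     = 0
rank (φ ⇒ ψ) = rank φ ⊔ rank ψ
rank (all φ) = suc (rank φ)

free-mono : ∀ {M N O} → M ≤ N → FreeBelow N O → FreeBelow M O
free-mono M≤N free x k<M l<M = free x (<-≤-trans k<M M≤N) (<-≤-trans l<M M≤N)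

-- A universal quantifier is a challenge in `H` answered in `G`, and antecedents exchange the two,
-- so both sides consist of copies. The bound `rank φ ≤ r` lets both halves of an implication share
-- one radius.
sat-transfer : ∀ G H {m r} {g : Fin n → copies G .Pt} {h : Fin n → copies H .Pt} {ρ σ} →
  FreeBelow (radius r) (copies G) → FreeBelow (radius r) (copies H) →
  Similar (copies G) (copies H) (radius r) g h →
  (∀ i → Match (copies G) (copies H) g h (ρ i) (σ i)) →
  (φ : Formula m) → rank φ ≤ r → Sat (chain (copies G)) ρ φ → Sat (chain (copies H)) σ φ
sat-transfer G H {r = r} {g} {h} {ρ} {σ} _ _ (t , _) ρσ (s ≈ u) _ eq
  with match-evalT _ _ ρσ s | match-evalT _ _ ρσ u
... | d , eq₁ , eq₂ | e , eq₃ , eq₄ = begin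
  _       ≡⟨ eq₂ ⟩
  map h d ≡⟨ map-≡ (copies G) (copies H) (transfers-mono (copies G) (copies H) (2≤radius r) t) d e
               (trans (sym eq₁) (trans eq eq₃)) ⟩
  map h e ≡⟨ eq₄ ⟨
  _       ∎
sat-transfer G H {r = r} _ _ (t , _) ρσ (s ≼ u) _ le
  with match-evalT _ _ ρσ s | match-evalT _ _ ρσ u
... | d , eq₁ , eq₂ | e , eq₃ , eq₄ =
  subst₂ (_⊴_ (copies H)) (sym eq₂) (sym eq₄)
    (map-⊴ (copies G) (copies H) (transfers-mono (copies G) (copies H) (2≤radius r) t) d e
      (subst₂ (_⊴_ (copies G)) eq₁ eq₃ le))
sat-transfer G H _ _ _ _ fls _ ()
sat-transfer G H fG fH s ρσ (φ ⇒ ψ) le f x =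
  sat-transfer G H fG fH s ρσ ψ (m⊔n≤o⇒n≤o (rank φ) (rank ψ) le)
    (f (sat-transfer H G fH fG (swap s) (match-sym (copies G) (copies H) ∘ ρσ) φ
      (m⊔n≤o⇒m≤o (rank φ) (rank ψ) le) x))
sat-transfer G H {r = suc r} fG fH s ρσ (all φ) (s≤s le) f y
  with answer (copies H) G (free-mono {O = copies H} (m≤m+n _ _) fH)
         (free-mono {O = copies G} (m≤m+n _ _) fG) (swap s) y
... | x , _ , _ , _ , s′ , xy , weaken =
  sat-transfer G H (free-mono {O = copies G} (m≤m+n _ _) fG)
    (free-mono {O = copies H} (m≤m+n _ _) fH) (swap s′)
    (λ { zero    → match-sym (copies H) (copies G) xy
       ; (suc i) → match-sym (copies H) (copies G) (weaken (match-sym (copies G) (copies H) (ρσ i))) })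
    φ le (f x)

maxRank : List Sentence → ℕ
maxRank []      = 0
maxRank (σ ∷ Γ) = rank σ ⊔ maxRank Γ

noPoints : Fin 0 → P
noPoints ()

models-transfer : ∀ G H {r} →
  FreeBelow (radius r) (copies G) → FreeBelow (radius r) (copies H) →
  ∀ Γ → maxRank Γ ≤ r → ModelsAll (chain (copies G)) Γ → ModelsAll (chain (copies H)) Γ
models-transfer G H fG fH []      _  _       = tt
models-transfer G H fG fH (σ ∷ Γ) le (m , ms) =
  -- With no points played yet, similarity is vacuous.
  sat-transfer G H {g = noPoints} {h = noPoints} fG fH ((λ ()) , λ ()) (λ ()) σ
    (m⊔n≤o⇒m≤o (rank σ) (maxRank Γ) le) m ,
  models-transfer G H fG fH Γ (m⊔n≤o⇒n≤o (rank σ) (maxRank Γ) le) ms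

-- The integer line and the finite cycles.

line : Orbit
line .Pt = ℤ
line .origin = 0ℤ
line ._≟_ = ℤ._≟_
line .shift k x = + k ℤ.+ x
line .unshift k x = ℤ.- + k ℤ.+ x
line .shift-zero = ℤ.+-identityˡ
line .shift-+ j k x = sym (ℤ.+-assoc (+ j) (+ k) x)
line .shift-unshift k x = begin
  + k ℤ.+ (ℤ.- + k ℤ.+ x) ≡⟨ ℤ.+-assoc (+ k) (ℤ.- + k) x ⟨
  + k ℤ.+ ℤ.- + k ℤ.+ x   ≡⟨ cong (ℤ._+ x) (ℤ.+-inverseʳ (+ k)) ⟩
  0ℤ ℤ.+ x                ≡⟨ ℤ.+-identityˡ x ⟩
  x                       ∎
line .unshift-shift k x = begin
  ℤ.- + k ℤ.+ (+ k ℤ.+ x) ≡⟨ ℤ.+-assoc (ℤ.- + k) (+ k) x ⟨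
  ℤ.- + k ℤ.+ + k ℤ.+ x   ≡⟨ cong (ℤ._+ x) (ℤ.+-inverseˡ (+ k)) ⟩
  0ℤ ℤ.+ x                ≡⟨ ℤ.+-identityˡ x ⟩
  x                       ∎

line-free : ∀ {B} → FreeBelow B line
line-free x _ _ eq = ℤ.+-injective (∙-cancelʳ x _ _ eq)

module _ (m : ℕ) where

  private L = suc m

  rotate : ℕ → Fin L → Fin L
  rotate k x = (k + toℕ x) mod L

  toℕ-rotate : ∀ k x → toℕ (rotate k x) ≡ (k + toℕ x) % L
  toℕ-rotate k x = toℕ-fromℕ< _

  toℕ-% : (x : Fin L) → toℕ x % L ≡ toℕ x
  toℕ-% x = m<n⇒m%n≡m (toℕ<n x)

  rotate-zero : ∀ x → rotate 0 x ≡ x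
  rotate-zero x = toℕ-injective (trans (toℕ-rotate 0 x) (toℕ-% x))

  rotate-+ : ∀ j k x → rotate j (rotate k x) ≡ rotate (j + k) x
  rotate-+ j k x = toℕ-injective (begin
    toℕ (rotate j (rotate k x))           ≡⟨ toℕ-rotate j _ ⟩
    (j + toℕ (rotate k x)) % L            ≡⟨ cong (λ i → (j + i) % L) (toℕ-rotate k x) ⟩
    (j + (k + toℕ x) % L) % L             ≡⟨ %-distribˡ-+ j _ L ⟩
    (j % L + (k + toℕ x) % L % L) % L     ≡⟨ cong (λ i → (j % L + i) % L) (m%n%n≡m%n (k + toℕ x) L) ⟩
    (j % L + (k + toℕ x) % L) % L         ≡⟨ %-distribˡ-+ j (k + toℕ x) L ⟨
    (j + (k + toℕ x)) % L                 ≡⟨ cong (_% L) (+-assoc j k (toℕ x)) ⟨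
    (j + k + toℕ x) % L                   ≡⟨ toℕ-rotate (j + k) x ⟨
    toℕ (rotate (j + k) x)                ∎)

  rotate-period : ∀ k x → rotate (k * L) x ≡ x
  rotate-period k x = toℕ-injective (begin
    toℕ (rotate (k * L) x) ≡⟨ toℕ-rotate (k * L) x ⟩
    (k * L + toℕ x) % L    ≡⟨ cong (_% L) (+-comm (k * L) (toℕ x)) ⟩
    (toℕ x + k * L) % L    ≡⟨ [m+kn]%n≡m%n (toℕ x) k L ⟩
    toℕ x % L              ≡⟨ toℕ-% x ⟩
    toℕ x                  ∎)

  cycle : Orbit
  cycle .Pt = Fin L
  cycle .origin = zero
  cycle ._≟_ = _≟ᶠ_
  cycle .shift = rotate
  -- Modulo `L`, `m` is `-1`, so rotating by `k * m` undoes rotating by `k`.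
  cycle .unshift k = rotate (k * m)
  cycle .shift-zero = rotate-zero
  cycle .shift-+ = rotate-+
  cycle .shift-unshift k x = begin
    rotate k (rotate (k * m) x) ≡⟨ rotate-+ k (k * m) x ⟩
    rotate (k + k * m) x        ≡⟨ cong (λ j → rotate j x) (*-suc k m) ⟨
    rotate (k * L) x            ≡⟨ rotate-period k x ⟩
    x                           ∎
  cycle .unshift-shift k x = begin
    rotate (k * m) (rotate k x) ≡⟨ rotate-+ (k * m) k x ⟩
    rotate (k * m + k) x        ≡⟨ cong (λ j → rotate j x) (+-comm (k * m) k) ⟩
    rotate (k + k * m) x        ≡⟨ cong (λ j → rotate j x) (*-suc k m) ⟨
    rotate (k * L) x            ≡⟨ rotate-period k x ⟩
    x                           ∎

  toℕ-rotate-origin : ∀ {k} → k < L → toℕ (rotate k zero) ≡ k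
  toℕ-rotate-origin {k} k<L = begin
    toℕ (rotate k zero) ≡⟨ toℕ-rotate k zero ⟩
    (k + 0) % L         ≡⟨ cong (_% L) (+-identityʳ k) ⟩
    k % L               ≡⟨ m<n⇒m%n≡m k<L ⟩
    k                   ∎

  -- Rotation by `toℕ x` carries the origin to `x` and cancels; at the origin, offsets below `L` are
  -- read off as positions.
  cycle-free : FreeBelow L cycle
  cycle-free x {k} {l} k<L l<L eq = begin
    k                   ≡⟨ toℕ-rotate-origin k<L ⟨
    toℕ (rotate k zero) ≡⟨ cong toℕ (shift-injective cycle (toℕ x) (begin
      rotate (toℕ x) (rotate k zero) ≡⟨ from-origin k ⟩
      rotate k x                     ≡⟨ eq ⟩
      rotate l x                     ≡⟨ from-origin l ⟨
      rotate (toℕ x) (rotate l zero) ∎)) ⟩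
    toℕ (rotate l zero) ≡⟨ toℕ-rotate-origin l<L ⟩
    l                   ∎
    where
    from-origin : ∀ j → rotate (toℕ x) (rotate j zero) ≡ rotate j x
    from-origin j = begin
      rotate (toℕ x) (rotate j zero) ≡⟨ rotate-+ (toℕ x) j zero ⟩
      rotate (toℕ x + j) zero        ≡⟨ cong (λ i → rotate i zero) (+-comm (toℕ x) j) ⟩
      rotate (j + toℕ x) zero        ≡⟨ rotate-+ j (toℕ x) zero ⟨
      rotate j (rotate (toℕ x) zero) ≡⟨ cong (rotate j) (toℕ-injective (toℕ-rotate-origin (toℕ<n x))) ⟩
      rotate j x                     ∎

-- Periodic orbits have no representation.

module _ (O : Orbit) where

  periodic⇒¬InR : ∀ m (x : O .Pt) → O .shift (suc m) x ≡ x → ¬ InR (chain O)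
  periodic⇒¬InR m x period (X , f , _ , f-∘ , f-≤) = p≰q (f-≤ p q .proj₂ p⊑q)
    where
    s : ℕ → O .Pt
    s k = O .shift k x

    p≰q : ¬ (_⊴_ O p q)
    p≰q ()

    below : ∀ y → _⊴_ O (a (O .shift 1 y)) (b y)
    below y = refl

    dom-a⇒b : ∀ y u → dom (f (a y)) u → dom (f (b y)) u
    dom-a⇒b y u (v , uv) = let z , uz , _ = f-∘ (b y) c .proj₁ u v uv in z , uz

    -- Refinement puts the domain of the larger `b (s k)` inside that of the smaller
    -- `a (s (suc k))`, so the domains of `a` grow along the orbit.
    dom-suc : ∀ k u → dom (f (a (s k))) u → dom (f (a (s (suc k)))) u
    dom-suc k u d = subst (λ y → dom (f (a y)) u) (O .shift-+ 1 k x)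
      (f-≤ _ _ .proj₁ (below (s k)) .proj₁ u (dom-a⇒b (s k) u d))

    dom-all : ∀ k u → dom (f (a (s 1))) u → dom (f (a (s (suc k)))) u
    dom-all zero    u d = d
    dom-all (suc k) u d = dom-suc (suc k) u (dom-all k u d)

    dom-a⇒b-back : ∀ u → dom (f (a (s 1))) u → dom (f (b x)) u
    -- After `m` more steps from `s 1` the orbit is back at `x`, which closes the chain of
    -- inclusions.
    dom-a⇒b-back u d = dom-a⇒b x u (subst (λ y → dom (f (a y)) u) period (dom-all m u d))

    p⊑q : f p ⊑ f q
    p⊑q .proj₁ u (v , uv) =
      let z , uz , zv = f-∘ w (b x) .proj₁ u v uv
          t , zt = f-≤ _ _ .proj₁ (below x) .proj₁ z (v , zv)
      in t , f-∘ w (a (s 1)) .proj₂ u t (z , uz , zt)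
    -- The midpoint `z` lies in the domain of `b x`, where refinement turns the edge of `a (s 1)`
    -- into one of `b x`.
    p⊑q .proj₂ u v _ uv =
      let z , uz , zv = f-∘ w (a (s 1)) .proj₁ u v uv
      in f-∘ w (b x) .proj₂ u v
           (z , uz , f-≤ _ _ .proj₁ (below x) .proj₂ z v (dom-a⇒b-back z (v , zv)) zv)

  -- An explicit representation for aperiodic orbits.

  Aperiodic : Set
  Aperiodic = ∀ k x → O .shift (suc k) x ≢ x

  infix 4 _⪯_

  _⪯_ : O .Pt → O .Pt → Set
  t ⪯ g = ∃ λ k → g ≡ O .shift k t

  ⪯-refl : ∀ {g} → g ⪯ g
  ⪯-refl = 0 , sym (O .shift-zero _)

  ⪯-shift : ∀ {t g} → t ⪯ g → t ⪯ O .shift 1 g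
  ⪯-shift {t} (k , refl) = suc k , O .shift-+ 1 k t

  -- The `x t` are midpoints of `w` with `a` and `b`; `y₁` and `y₂` precede `c` on the way to `z`
  -- and `z′`, and `y g` on the way from `v` to `e g`.
  data Base : Set where
    u v z z′ y₁ y₂ : Base
    x e y          : O .Pt → Base

  -- From x t the elements a g, b g are defined exactly when g is on the forward
  -- orbit of t.  The pair (u , z′) of p arises only through x g, outside the
  -- domain of b at the predecessor of g, so it is not forced into q.  The point
  -- v only serves to separate the elements a g, b g from each other.
  data Rep : Element (O .Pt) → BinRel Base where
    w-x  : ∀ {t} → Rep w u (x t)
    p-z  : Rep p u z
    p-z′ : Rep p u z′
    q-z  : Rep q u z
    q-y₁ : Rep q u y₁
    q-y₂ : Rep q u y₂
    c-z  : Rep c y₁ z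
    c-z′ : Rep c y₂ z′
    c-e  : ∀ {g} → Rep c (y g) (e g)
    a-z  : ∀ {t g} → t ⪯ g → Rep (a g) (x t) z
    a-z′ : ∀ {g} → Rep (a g) (x g) z′
    a-e  : ∀ {g} → Rep (a g) v (e g)
    b-z  : ∀ {t g} → t ⪯ g → Rep (b g) (x t) z
    b-y₁ : ∀ {t g} → t ⪯ g → Rep (b g) (x t) y₁
    b-y₂ : ∀ {g} → Rep (b g) (x g) y₂
    b-e  : ∀ {g} → Rep (b g) v (e (O .shift 1 g))
    b-y  : ∀ {g} → Rep (b g) v (y g)

  rep-factor : ∀ d e → Rep (d ∙ e) ⊆ᵣ (Rep d ⨾ Rep e)
  rep-factor w     (a g) _ _ p-z     = x g , w-x , a-z ⪯-refl
  rep-factor w     (a g) _ _ p-z′    = x g , w-x , a-z′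
  rep-factor w     (b g) _ _ q-z     = x g , w-x , b-z ⪯-refl
  rep-factor w     (b g) _ _ q-y₁    = x g , w-x , b-y₁ ⪯-refl
  rep-factor w     (b g) _ _ q-y₂    = x g , w-x , b-y₂
  rep-factor q     c     _ _ p-z     = y₁ , q-y₁ , c-z
  rep-factor q     c     _ _ p-z′    = y₂ , q-y₂ , c-z′
  rep-factor (b g) c     _ _ (a-z l) = y₁ , b-y₁ l , c-z
  rep-factor (b g) c     _ _ a-z′    = y₂ , b-y₂ , c-z′
  rep-factor (b g) c     _ _ a-e     = y g , b-y , c-e

  -- Only the listed pairs of edges meet, so all products equal to `o` are empty compositions.
  rep-compose : ∀ d e → (Rep d ⨾ Rep e) ⊆ᵣ Rep (d ∙ e)
  rep-compose _ _ _ _ (_ , w-x    , a-z _)  = p-z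
  rep-compose _ _ _ _ (_ , w-x    , a-z′)   = p-z′
  rep-compose _ _ _ _ (_ , w-x    , b-z _)  = q-z
  rep-compose _ _ _ _ (_ , w-x    , b-y₁ _) = q-y₁
  rep-compose _ _ _ _ (_ , w-x    , b-y₂)   = q-y₂
  rep-compose _ _ _ _ (_ , q-y₁   , c-z)    = p-z
  rep-compose _ _ _ _ (_ , q-y₂   , c-z′)   = p-z′
  rep-compose _ _ _ _ (_ , b-y₁ l , c-z)    = a-z l
  rep-compose _ _ _ _ (_ , b-y₂   , c-z′)   = a-z′
  rep-compose _ _ _ _ (_ , b-y    , c-e)    = a-e

  ≡⇒⊑ : ∀ {d e} → d ≡ e → Rep d ⊑ Rep e
  ≡⇒⊑ refl = (λ _ r → r) , λ _ _ _ r → r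

  ⊴⇒⊑ : Aperiodic → ∀ d e → _⊴_ O d e → Rep d ⊑ Rep e
  -- `Rep o` is empty, and the empty relation is the top of demonic refinement.
  ⊴⇒⊑ ap d o _ = (λ { _ (_ , ()) }) , λ { _ _ (_ , ()) }
  ⊴⇒⊑ ap (a _) (b g) refl = doms , edges
    where
    doms : ∀ m → dom (Rep (b g)) m → dom (Rep (a (O .shift 1 g))) m
    doms _ (_ , b-z l)  = _ , a-z (⪯-shift l)
    doms _ (_ , b-y₁ l) = _ , a-z (⪯-shift l)
    doms _ (_ , b-y₂)   = _ , a-z (⪯-shift ⪯-refl)
    doms _ (_ , b-e)    = _ , a-e
    doms _ (_ , b-y)    = _ , a-e

    ¬suc⪯ : ¬ (O .shift 1 g ⪯ g)
    ¬suc⪯ (k , eq) = ap k g (begin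
      O .shift (suc k) g         ≡⟨ cong (λ j → O .shift j g) (+-comm 1 k) ⟩
      O .shift (k + 1) g         ≡⟨ O .shift-+ k 1 g ⟨
      O .shift k (O .shift 1 g)  ≡⟨ eq ⟨
      g                          ∎)

    defined : ∀ {t} → dom (Rep (b g)) (x t) → t ⪯ g
    defined (_ , b-z l)  = l
    defined (_ , b-y₁ l) = l
    defined (_ , b-y₂)   = ⪯-refl

    edges : ∀ m n → dom (Rep (b g)) m → Rep (a (O .shift 1 g)) m n → Rep (b g) m n
    edges _ _ d (a-z _) = b-z (defined d)
    -- This edge leaves only `x (shift 1 g)`, from which an aperiodic orbit never returns to `g`, so
    -- `b g` is undefined there.
    edges _ _ d a-z′    = ⊥-elim (¬suc⪯ (defined d))
    edges _ _ d a-e     = b-e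
  ⊴⇒⊑ ap (b g) (b h) eq = ≡⇒⊑ eq
  ⊴⇒⊑ ap d     w     eq = ≡⇒⊑ eq
  ⊴⇒⊑ ap d     p     eq = ≡⇒⊑ eq
  ⊴⇒⊑ ap d     q     eq = ≡⇒⊑ eq
  ⊴⇒⊑ ap d     c     eq = ≡⇒⊑ eq
  ⊴⇒⊑ ap d     (a h) eq = ≡⇒⊑ eq

  e-injective : ∀ {g h} → e g ≡ e h → g ≡ h
  e-injective refl = refl

  a-target : ∀ {g m} → Rep (a g) v m → m ≡ e g
  a-target a-e = refl

  b-target : ∀ {g h} → Rep (b g) v (e h) → h ≡ O .shift 1 g
  b-target b-e = refl

  -- A source in the domain of `f` must have an edge of `d`, which leaves few candidates; each wrong
  -- one has an edge there that `f` lacks.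
  ⊑⇒⊴ : ∀ d f → Rep d ⊑ Rep f → _⊴_ O d f
  ⊑⇒⊴ d o _ = tt
  -- Any point would witness that `u` is in the domain of `w`; the origin provides one.
  ⊑⇒⊴ d w (doms , edges) with doms u (x (O .origin) , w-x)
  ... | _ , w-x  = refl
  ... | _ , p-z  with () ← edges u z (x (O .origin) , w-x) p-z
  ... | _ , p-z′ with () ← edges u z′ (x (O .origin) , w-x) p-z′
  ... | _ , q-z  with () ← edges u z (x (O .origin) , w-x) q-z
  ... | _ , q-y₁ with () ← edges u y₁ (x (O .origin) , w-x) q-y₁
  ... | _ , q-y₂ with () ← edges u y₂ (x (O .origin) , w-x) q-y₂
  ⊑⇒⊴ d p (doms , edges) with doms u (z , p-z)
  ... | _ , w-x {t} with () ← edges u (x t) (z , p-z) w-x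
  ... | _ , p-z  = refl
  ... | _ , p-z′ = refl
  ... | _ , q-z  with () ← edges u y₁ (z , p-z) q-y₁
  ... | _ , q-y₁ with () ← edges u y₁ (z , p-z) q-y₁
  ... | _ , q-y₂ with () ← edges u y₁ (z , p-z) q-y₁
  ⊑⇒⊴ d q (doms , edges) with doms u (z , q-z)
  ... | _ , w-x {t} with () ← edges u (x t) (z , q-z) w-x
  ... | _ , p-z  with () ← edges u z′ (z , q-z) p-z′
  ... | _ , p-z′ with () ← edges u z′ (z , q-z) p-z′
  ... | _ , q-z  = refl
  ... | _ , q-y₁ = refl
  ... | _ , q-y₂ = refl
  ⊑⇒⊴ d c (doms , edges) with doms y₁ (z , c-z)
  ... | _ , c-z = refl
  ⊑⇒⊴ d (a h) (doms , edges) with doms v (e h , a-e)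
  ... | _ , a-e {g} = cong a (e-injective (a-target (edges v (e g) (e h , a-e) a-e)))
  ... | _ , b-e {g} with () ← edges v (y g) (e h , a-e) b-y
  ... | _ , b-y {g} with () ← edges v (y g) (e h , a-e) b-y
  ⊑⇒⊴ d (b h) (doms , edges) with doms v (y h , b-y)
  ... | _ , a-e {g} = b-target (edges v (e g) (y h , b-y) a-e)
  ... | _ , b-e {g} with b-y ← edges v (y g) (y h , b-y) b-y = refl
  ... | _ , b-y {g} with b-y ← edges v (y g) (y h , b-y) b-y = refl

  -- Equal relations refine each other, so antisymmetry turns order reflection into injectivity.
  ⊴-antisym : ∀ d f → _⊴_ O d f → _⊴_ O f d → d ≡ f
  ⊴-antisym o     o     _  _ = refl
  ⊴-antisym (b _) (b _) eq _ = eq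
  ⊴-antisym d     w     eq _ = eq
  ⊴-antisym d     p     eq _ = eq
  ⊴-antisym d     q     eq _ = eq
  ⊴-antisym d     c     eq _ = eq
  ⊴-antisym d     (a _) eq _ = eq

  ≐⇒⊑ : ∀ {X : Set} {R S : BinRel X} → R ≐ S → R ⊑ S
  ≐⇒⊑ (R⊆S , S⊆R) = (λ m (n , mn) → n , S⊆R m n mn) , λ m n _ → R⊆S m n

  aperiodic⇒InR : Aperiodic → InR (chain O)
  aperiodic⇒InR ap = Base , Rep
    , (λ d f eq → ⊴-antisym d f (⊑⇒⊴ d f (≐⇒⊑ eq)) (⊑⇒⊴ f d (≐⇒⊑ (swap eq))))
    , (λ d f → rep-factor d f , rep-compose d f)
    , λ d f → ⊴⇒⊑ ap d f , ⊑⇒⊴ d f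

-- Long cycles against the line.

theorem10 : ¬ Σ (List Sentence) Axiomatises
theorem10 (Γ , ax) =
  periodic⇒¬InR (copies C) m (copies C .origin) (cong (0 ,_) period)
    (ax (chain (copies C)) .proj₁ (models-transfer line C
      (copies-free line line-free) (copies-free C (free-mono {O = C} (n≤1+n m) (cycle-free m)))
      Γ ≤-refl (ax (chain (copies line)) .proj₂ line∈R)))
  where
  -- The cycle has length `suc m`, just beyond the radius that the sentences of `Γ` can inspect.
  m = radius (maxRank Γ)
  C = cycle m

  period : rotate m (suc m) zero ≡ zero
  period = subst (λ k → rotate m k zero ≡ zero) (*-identityˡ (suc m)) (rotate-period m 1 zero)

  line∈R : InR (chain (copies line))
  line∈R = aperiodic⇒InR (copies line) λ k x eq →
    -- The line is free below every bound, here `suc (suc k)`, so offsets `suc k` and `0` cannot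
    -- agree.
    1+n≢0 (copies-free line line-free x {suc k} {0} ≤-refl (s≤s z≤n)
      (trans eq (sym (copies line .shift-zero x))))
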